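{- For every integer $n\geq 3$, the Sigma index of the caterpillar tree $C(n,3)$ is $$\sigma(C(n,3)) = 48(n-2)+56.$$
   Context: All graphs are finite, simple and undirected. For a graph $G$ with edge set $E(G)$, $d_G(v)$ denotes the degree of the vertex $v$. The Sigma index of $G$ is $\sigma(G)=\sum_{uv\in E(G)}(d_G(u)-d_G(v))^2$. For positive integers $n,m$, the caterpillar tree $C(n,m)$ is the tree consisting of a path $x_1x_2\cdots x_n$ on $n$ vertices (the main vertices) together with, for each $i=1,\dots,n$, exactly $m$ pendent vertices (leaves) adjacent to $x_i$, these leaves being distinct for distinct $i$. In particular, in $C(n,3)$ each of the $n$ path vertices has exactly three pendent vertices attached. -}

module Defs where

open import Data.Empty using (⊥)
open import Data.Fin using (Fin; toℕ)
import Data.Fin.Properties as Fin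
open import Data.Integer using (ℤ; +_; 0ℤ; _+_; _-_; _^_)
open import Data.List using (List; []; _∷_; _++_; map; filter; foldr; length; allFin; cartesianProductWith)
open import Data.List.Membership.Propositional using (_∈_)
open import Data.List.Membership.Propositional.Properties
  using (∈-map⁺; ∈-map⁻; ∈-++⁺ˡ; ∈-++⁺ʳ; ∈-allFin; ∈-cartesianProductWith⁺; ∈-cartesianProductWith⁻)
open import Data.List.Relation.Unary.Unique.Propositional using (Unique)
import Data.List.Relation.Unary.Unique.Propositional.Properties as Unique
open import Data.Nat using (ℕ; suc)
import Data.Nat.Properties as ℕ
open import Data.Product using (_×_; _,_; uncurry)
open import Data.Sum using (_⊎_; inj₁; inj₂; swap)
open import Relation.Binary.Core using (Rel)
open import Relation.Binary.Definitions using (Decidable; Symmetric; Irreflexive)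
open import Relation.Binary.PropositionalEquality using (_≡_; refl; sym)
open import Relation.Nullary using (no)
open import Relation.Nullary.Decidable using (_⊎-dec_)
open import Level using (0ℓ)

-- Finiteness is a duplicate-free list of all the vertices; the degree and
-- the Sigma index below do not depend on the order of that list.
record Graph : Set₁ where
  field
    V          : Set
    Adj        : Rel V 0ℓ
    Adj?       : Decidable Adj
    Adj-sym    : Symmetric Adj
    Adj-irrefl : Irreflexive _≡_ Adj
    vertices   : List V
    complete   : ∀ v → v ∈ vertices
    unique     : Unique vertices

-- For a duplicate-free list, every two-element subset of its entries occurs
-- exactly once, in one of its two orderings.
pairs : {A : Set} → List A → List (A × A)
pairs []       = []
pairs (x ∷ xs) = map (x ,_) xs ++ pairs xs

sumℤ : List ℤ → ℤ
sumℤ = foldr _+_ 0ℤ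

module _ (G : Graph) where
  open Graph G

  degree : V → ℕ
  degree v = length (filter (Adj? v) vertices)

  -- Each undirected edge is listed once.
  edges : List (V × V)
  edges = filter (uncurry Adj?) (pairs vertices)

  σ : ℤ
  σ = sumℤ (map (λ (u , v) → (+ degree u - + degree v) ^ 2) edges)

-- main i is the path vertex x_{i+1} (indices start at 0 here), and
-- leaf i k is the k-th pendent vertex attached to it.
data CatVertex (n m : ℕ) : Set where
  main : Fin n → CatVertex n m
  leaf : Fin n → Fin m → CatVertex n m

module _ {n m : ℕ} where

  CatAdj : Rel (CatVertex n m) 0ℓ
  CatAdj (main i)   (main j)   = toℕ j ≡ suc (toℕ i) ⊎ toℕ i ≡ suc (toℕ j)
  CatAdj (main i)   (leaf j _) = i ≡ j
  CatAdj (leaf i _) (main j)   = i ≡ j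
  CatAdj (leaf _ _) (leaf _ _) = ⊥

  CatAdj? : Decidable CatAdj
  CatAdj? (main i)   (main j)   = (toℕ j ℕ.≟ suc (toℕ i)) ⊎-dec (toℕ i ℕ.≟ suc (toℕ j))
  CatAdj? (main i)   (leaf j _) = i Fin.≟ j
  CatAdj? (leaf i _) (main j)   = i Fin.≟ j
  CatAdj? (leaf _ _) (leaf _ _) = no λ ()

  CatAdj-sym : Symmetric CatAdj
  CatAdj-sym {main _}   {main _}   = swap
  CatAdj-sym {main _}   {leaf _ _} = sym
  CatAdj-sym {leaf _ _} {main _}   = sym
  CatAdj-sym {leaf _ _} {leaf _ _} ()

  CatAdj-irrefl : Irreflexive _≡_ CatAdj
  CatAdj-irrefl {main _}   refl (inj₁ p) = ℕ.1+n≢n (sym p)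
  CatAdj-irrefl {main _}   refl (inj₂ p) = ℕ.1+n≢n (sym p)
  CatAdj-irrefl {leaf _ _} refl ()

catVertices : (n m : ℕ) → List (CatVertex n m)
catVertices n m = map main (allFin n) ++ cartesianProductWith leaf (allFin n) (allFin m)

catVertices-complete : ∀ {n m} (v : CatVertex n m) → v ∈ catVertices n m
catVertices-complete (main i) = ∈-++⁺ˡ (∈-map⁺ main (∈-allFin i))
catVertices-complete {n} (leaf i k) =
  ∈-++⁺ʳ (map main (allFin n)) (∈-cartesianProductWith⁺ leaf (∈-allFin i) (∈-allFin k))

catVertices-unique : ∀ n m → Unique (catVertices n m)
catVertices-unique n m = Unique.++⁺
  (Unique.map⁺ (λ { refl → refl }) (Unique.allFin⁺ n))
  (Unique.cartesianProductWith⁺ leaf (λ { refl → refl , refl }) (Unique.allFin⁺ n) (Unique.allFin⁺ m))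
  disjoint
  where
  disjoint : ∀ {v} → v ∈ map main (allFin n) × v ∈ cartesianProductWith leaf (allFin n) (allFin m) → ⊥
  disjoint (p , q) with ∈-map⁻ main p | ∈-cartesianProductWith⁻ leaf (allFin n) (allFin m) q
  ... | _ , _ , refl | _ , _ , _ , _ , ()

C : (n m : ℕ) → Graph
C n m = record
  { V          = CatVertex n m
  ; Adj        = CatAdj
  ; Adj?       = CatAdj?
  ; Adj-sym    = λ {u} {v} → CatAdj-sym {x = u} {y = v}
  ; Adj-irrefl = λ {u} {v} → CatAdj-irrefl {x = u} {y = v}
  ; vertices   = catVertices n m
  ; complete   = catVertices-complete
  ; unique     = catVertices-unique n m
  }

{-# OPTIONS --safe #-}

-- Up to order, the edges of C(n,m) are the n − 1 path edges and the n m pendant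
-- edges. Path vertices have degree m + 2, except that the two end vertices have
-- degree m + 1, and leaves have degree 1. For m = 3 the two outermost path edges
-- contribute 1 each, and the three pendant edges at a path vertex contribute
-- 3 · 3² = 27 at the two ends and 3 · 4² = 48 elsewhere.
module Submission where

open import Defs
open import Data.Nat using (ℕ; _≥_)
open import Data.Integer using (+_; _+_; _*_; _-_)
open import Relation.Binary.PropositionalEquality using (_≡_)

open import Data.Bool using (true; false)
open import Data.Fin using (Fin; zero; suc)
import Data.Fin.Properties as Fin
open import Data.Integer using (ℤ; _^_)
import Data.Integer.Properties as ℤ
open import Data.Integer.Tactic.RingSolver using (solve-∀)
open import Data.List
  using (List; []; _∷_; _++_; map; filter; length; allFin; cartesianProduct; cartesianProductWith)
open import Data.List.Properties
  using ( ++-identityʳ; filter-++; filter-all; filter-none; filter-≐; length-++; length-map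
        ; length-tabulate; map-++; map-∘; map-cong; map-tabulate)
open import Data.List.Relation.Binary.Permutation.Propositional
  using (_↭_; ↭-refl; ↭⇒↭ₛ; module PermutationReasoning)
open import Data.List.Relation.Binary.Permutation.Propositional.Properties
  using (++⁺ˡ; ++-assoc; filter-↭; map⁺; shifts)
import Data.List.Relation.Binary.Permutation.Setoid.Properties as Permutation
open import Data.List.Relation.Unary.All using (All; []; _∷_; universal)
import Data.List.Relation.Unary.All as All
import Data.List.Relation.Unary.All.Properties as All
open import Data.Nat using (zero; suc; s≤s; _⊓_) renaming (_+_ to _+ℕ_)
import Data.Nat.Properties as ℕ
open import Data.Product using (_×_; _,_; proj₁; proj₂; ∃₂; uncurry) renaming (map to map×)
open import Data.Sum using (inj₁; inj₂)
import Data.Sum as Sum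
open import Function using (_∘_; id; const)
open import Level using (0ℓ)
open import Relation.Binary.PropositionalEquality
  using (refl; sym; trans; cong; cong₂; setoid; module ≡-Reasoning)
open import Relation.Nullary using (¬_; does; yes; no)
open import Relation.Unary using (Pred; Decidable; _≐_)

private variable
  A B D : Set
  n m : ℕ

-- Lists

-- `Q?` is a separate argument because `P? ∘ f` and the decision procedure wanted on the right may
-- differ as terms; logical equivalence of the predicates is enough.
filter-map : {P : Pred B 0ℓ} {Q : Pred A 0ℓ} (P? : Decidable P) (Q? : Decidable Q) (f : A → B) →
  P ∘ f ≐ Q → ∀ xs → filter P? (map f xs) ≡ map f (filter Q? xs)
filter-map P? Q? f P∘f≐Q xs = trans (commute xs) (cong (map f) (filter-≐ (P? ∘ f) Q? P∘f≐Q xs))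
  where
  commute : ∀ xs → filter P? (map f xs) ≡ map f (filter (P? ∘ f) xs)
  commute []       = refl
  commute (x ∷ xs) with does (P? (f x))
  ... | true  = cong (f x ∷_) (commute xs)
  ... | false = commute xs

filter-map-none : {P : Pred B 0ℓ} (P? : Decidable P) (f : A → B) →
  (∀ x → ¬ P (f x)) → ∀ xs → filter P? (map f xs) ≡ []
filter-map-none P? f ¬P xs = filter-none P? (All.map⁺ (universal ¬P xs))

All-cartesianProductWith : {P : Pred D 0ℓ} (f : A → B → D) →
  (∀ x y → P (f x y)) → ∀ xs ys → All P (cartesianProductWith f xs ys)
All-cartesianProductWith f p []       ys = []
All-cartesianProductWith f p (x ∷ xs) ys =
  All.++⁺ (All.map⁺ (universal (p x) ys)) (All-cartesianProductWith f p xs ys)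

-- Membership depends on `x` alone, so every row `map (f x) ys` survives or disappears as a whole.
filter-cartesianProductWith : {P : Pred D 0ℓ} {Q : Pred A 0ℓ}
  (P? : Decidable P) (Q? : Decidable Q) (f : A → B → D) → (∀ y → (λ x → P (f x y)) ≐ Q) →
  ∀ xs ys → filter P? (cartesianProductWith f xs ys) ≡ cartesianProductWith f (filter Q? xs) ys
filter-cartesianProductWith P? Q? f eq []       ys = refl
filter-cartesianProductWith P? Q? f eq (x ∷ xs) ys
  rewrite filter-++ P? (map (f x) ys) (cartesianProductWith f xs ys)
        | filter-cartesianProductWith P? Q? f eq xs ys
  with Q? x
... | yes q = cong (_++ _) (filter-all P? (All.map⁺ (universal (λ y → proj₂ (eq y) q) ys)))
... | no ¬q = cong (_++ _) (filter-map-none P? (f x) (λ y → ¬q ∘ proj₁ (eq y)) ys)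

pairs-map : (f : A → B) → ∀ xs → pairs (map f xs) ≡ map (map× f f) (pairs xs)
pairs-map f []       = refl
pairs-map f (x ∷ xs) = begin
  map (f x ,_) (map f xs) ++ pairs (map f xs)
    -- Both first summands are factorisations of one map, `λ y → f x , f y`, so `map-∘` is used once
    -- in each direction.
    ≡⟨ cong₂ _++_ (trans (sym (map-∘ xs)) (map-∘ xs)) (pairs-map f xs) ⟩
  map (map× f f) (map (x ,_) xs) ++ map (map× f f) (pairs xs)
    ≡⟨ map-++ (map× f f) (map (x ,_) xs) (pairs xs) ⟨
  map (map× f f) (pairs (x ∷ xs)) ∎
  where open ≡-Reasoning

-- Only a permutation: `pairs` lists the partners of `x` in `xs` and in `ys` before moving to the
-- next entry, so the mixed pairs start out interleaved with those inside `xs`.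
pairs-++ : (xs ys : List A) → pairs (xs ++ ys) ↭ pairs xs ++ cartesianProduct xs ys ++ pairs ys
pairs-++ []       ys = ↭-refl
pairs-++ (x ∷ xs) ys = begin
  map (x ,_) (xs ++ ys) ++ pairs (xs ++ ys)
    ≡⟨ cong (_++ pairs (xs ++ ys)) (map-++ (x ,_) xs ys) ⟩
  (map (x ,_) xs ++ map (x ,_) ys) ++ pairs (xs ++ ys)
    ↭⟨ ++-assoc (map (x ,_) xs) (map (x ,_) ys) _ ⟩
  map (x ,_) xs ++ map (x ,_) ys ++ pairs (xs ++ ys)
    ↭⟨ ++⁺ˡ (map (x ,_) xs) (++⁺ˡ (map (x ,_) ys) (pairs-++ xs ys)) ⟩
  map (x ,_) xs ++ map (x ,_) ys ++ pairs xs ++ cartesianProduct xs ys ++ pairs ys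
    ↭⟨ ++⁺ˡ (map (x ,_) xs) (shifts (map (x ,_) ys) (pairs xs)) ⟩
  map (x ,_) xs ++ pairs xs ++ map (x ,_) ys ++ cartesianProduct xs ys ++ pairs ys
    ↭⟨ ++⁺ˡ (map (x ,_) xs) (++⁺ˡ (pairs xs) (++-assoc (map (x ,_) ys) (cartesianProduct xs ys) _)) ⟨
  map (x ,_) xs ++ pairs xs ++ cartesianProduct (x ∷ xs) ys ++ pairs ys
    ↭⟨ ++-assoc (map (x ,_) xs) (pairs xs) _ ⟨
  pairs (x ∷ xs) ++ cartesianProduct (x ∷ xs) ys ++ pairs ys ∎
  where open PermutationReasoning

All-pairs : {P : Pred A 0ℓ} {R : Pred (A × A) 0ℓ} → (∀ {x y} → P x → P y → R (x , y)) →
  ∀ {xs} → All P xs → All R (pairs xs)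
All-pairs r []       = []
All-pairs r (px ∷ pxs) = All.++⁺ (All.map⁺ (All.map (r px) pxs)) (All-pairs r pxs)

-- The tail of `allFin` unfolds to `tabulate suc`; as a `map` it suits the inductions that peel off
-- the first path vertex.
allFin-suc : ∀ n → allFin (suc n) ≡ zero ∷ map suc (allFin n)
allFin-suc n = cong (zero ∷_) (sym (map-tabulate id suc))

filter-≟-allFin : (i : Fin n) → filter (i Fin.≟_) (allFin n) ≡ i ∷ []
filter-≟-allFin {suc n} zero    =
  trans (cong (filter (zero Fin.≟_)) (allFin-suc n))
        (cong (zero ∷_) (filter-map-none (zero Fin.≟_) suc (λ _ ()) (allFin n)))
filter-≟-allFin {suc n} (suc i) =
  trans (cong (filter (suc i Fin.≟_)) (allFin-suc n))
 (trans (filter-map (suc i Fin.≟_) (i Fin.≟_) suc (Fin.suc-injective , cong suc) (allFin n))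
        (cong (map suc) (filter-≟-allFin i)))

sumℤ-++ : ∀ xs ys → sumℤ (xs ++ ys) ≡ sumℤ xs + sumℤ ys
sumℤ-++ []       ys = sym (ℤ.+-identityˡ (sumℤ ys))
sumℤ-++ (x ∷ xs) ys = trans (cong (λ s → x + s) (sumℤ-++ xs ys)) (sym (ℤ.+-assoc x (sumℤ xs) (sumℤ ys)))

sumℤ-↭ : ∀ {xs ys} → xs ↭ ys → sumℤ xs ≡ sumℤ ys
sumℤ-↭ p = Permutation.foldr-commMonoid (setoid ℤ) ℤ.+-0-isCommutativeMonoid (↭⇒↭ₛ p)

sumℤ-map-∘ : (w : B → ℤ) (f : A → B) → ∀ xs → sumℤ (map w (map f xs)) ≡ sumℤ (map (w ∘ f) xs)
sumℤ-map-∘ w f xs = cong sumℤ (sym (map-∘ xs))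

sumℤ-cartesianProductWith : (w : D → ℤ) (f : A → B → D) → ∀ xs ys →
  sumℤ (map w (cartesianProductWith f xs ys)) ≡ sumℤ (map (λ x → sumℤ (map (w ∘ f x) ys)) xs)
sumℤ-cartesianProductWith w f []       ys = refl
sumℤ-cartesianProductWith w f (x ∷ xs) ys = begin
  sumℤ (map w (map (f x) ys ++ cartesianProductWith f xs ys))
    ≡⟨ cong sumℤ (map-++ w (map (f x) ys) _) ⟩
  sumℤ (map w (map (f x) ys) ++ map w (cartesianProductWith f xs ys))
    ≡⟨ sumℤ-++ (map w (map (f x) ys)) _ ⟩
  sumℤ (map w (map (f x) ys)) + sumℤ (map w (cartesianProductWith f xs ys))
    ≡⟨ cong₂ _+_ (sumℤ-map-∘ w (f x) ys) (sumℤ-cartesianProductWith w f xs ys) ⟩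
  sumℤ (map (λ x → sumℤ (map (w ∘ f x) ys)) (x ∷ xs)) ∎
  where open ≡-Reasoning

-- Degrees

leaves : ∀ n m → List (CatVertex n m)
leaves n m = cartesianProductWith leaf (allFin n) (allFin m)

-- Used twice: to count the leaf neighbours of `main i` and to list the pendant edges at it.
leaves-at : (i : Fin n) →
  filter (CatAdj? (main i)) (leaves n m) ≡ map (leaf i) (allFin m)
leaves-at {n} {m} i = begin
  filter (CatAdj? (main i)) (leaves n m)
    ≡⟨ filter-cartesianProductWith (CatAdj? (main i)) (i Fin.≟_) leaf (λ _ → id , id) (allFin n) (allFin m) ⟩
  cartesianProductWith leaf (filter (i Fin.≟_) (allFin n)) (allFin m)
    ≡⟨ cong (λ is → cartesianProductWith leaf is (allFin m)) (filter-≟-allFin i) ⟩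
  map (leaf i) (allFin m) ++ []
    ≡⟨ ++-identityʳ _ ⟩
  map (leaf i) (allFin m) ∎
  where open ≡-Reasoning

degree-leaf : (i : Fin n) (k : Fin m) → degree (C n m) (leaf i k) ≡ 1
degree-leaf {n} {m} i k = cong length (begin
  filter (CatAdj? (leaf i k)) (catVertices n m)
    ≡⟨ filter-++ (CatAdj? (leaf i k)) (map main (allFin n)) (leaves n m) ⟩
  filter (CatAdj? (leaf i k)) (map main (allFin n)) ++ filter (CatAdj? (leaf i k)) (leaves n m)
    ≡⟨ cong₂ _++_
         (filter-map (CatAdj? (leaf i k)) (i Fin.≟_) main (id , id) (allFin n))
         (filter-none (CatAdj? (leaf i k))
           (All-cartesianProductWith leaf (λ _ _ ()) (allFin n) (allFin m))) ⟩
  map main (filter (i Fin.≟_) (allFin n)) ++ []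
    ≡⟨ cong (λ is → map main is ++ []) (filter-≟-allFin i) ⟩
  main i ∷ [] ∎)
  where open ≡-Reasoning

-- Adjacency of main vertices unfolds to the same relation for every `m`; choosing 0 merely fixes
-- the parameter, and `id , id` later converts between the two.
PathAdj : Fin n → Fin n → Set
PathAdj {n} i j = CatAdj {n} {0} (main i) (main j)

PathAdj? : (i : Fin n) → Decidable (PathAdj i)
PathAdj? i j = CatAdj? {m = 0} (main i) (main j)

PathAdj-suc : (i : Fin n) → PathAdj (suc i) ∘ suc ≐ PathAdj i
PathAdj-suc i = Sum.map ℕ.suc-injective ℕ.suc-injective , Sum.map (cong suc) (cong suc)

-- The number of path neighbours of larger index.
after : Fin n → ℕ
after {suc n} zero    = 1 ⊓ n
after         (suc i) = after i

-- The first vertex has no earlier neighbour and every other has exactly one, the outer `suc`. In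
-- the last clause `after i` is already `after (suc i)`.
pathDegree : Fin n → ℕ
pathDegree {suc n} zero    = after {suc n} zero
pathDegree         (suc i) = suc (after i)

filter-PathAdj-zero : ∀ n → filter (PathAdj? zero) (map suc (allFin (suc n))) ≡ suc zero ∷ []
filter-PathAdj-zero n =
  trans (cong (filter (PathAdj? zero) ∘ map suc) (allFin-suc n))
        (cong (suc zero ∷_) (filter-none (PathAdj? zero)
          (All.map⁺ (All.map⁺ (universal (λ _ → λ { (inj₁ ()) ; (inj₂ ()) }) (allFin n))))))

length-filter-PathAdj-suc : (i : Fin n) →
  length (filter (PathAdj? (suc i)) (map suc (allFin n))) ≡ length (filter (PathAdj? i) (allFin n))
length-filter-PathAdj-suc {n} i =
  trans (cong length (filter-map (PathAdj? (suc i)) (PathAdj? i) suc (PathAdj-suc i) (allFin n)))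
        (length-map suc (filter (PathAdj? i) (allFin n)))

-- Vertex `zero` is peeled off. From index 2 on it is not adjacent, and `pathDegree (suc (suc i))`
-- reduces to `pathDegree (suc i)`, so the recursion closes.
length-filter-PathAdj : (i : Fin n) → length (filter (PathAdj? i) (allFin n)) ≡ pathDegree i
length-filter-PathAdj {suc zero}    zero = refl
length-filter-PathAdj {suc (suc n)} zero =
  trans (cong (length ∘ filter (PathAdj? zero)) (allFin-suc (suc n)))
        (cong length (filter-PathAdj-zero n))
length-filter-PathAdj {suc n} (suc zero) =
  trans (cong (length ∘ filter (PathAdj? (suc zero))) (allFin-suc n))
        -- The `suc` counts the neighbour `zero`; in the remaining path this vertex comes first, so
        -- only its later neighbour is left to count.
        (cong suc (trans (length-filter-PathAdj-suc {n} zero) (length-filter-PathAdj {n} zero)))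
length-filter-PathAdj {suc n} (suc (suc i)) =
  trans (cong (length ∘ filter (PathAdj? (suc (suc i)))) (allFin-suc n))
        (trans (length-filter-PathAdj-suc (suc i)) (length-filter-PathAdj (suc i)))

degree-main : (i : Fin n) → degree (C n m) (main i) ≡ pathDegree i +ℕ m
degree-main {n} {m} i = begin
  length (filter (CatAdj? (main i)) (catVertices n m))
    ≡⟨ cong length (filter-++ (CatAdj? (main i)) (map main (allFin n)) (leaves n m)) ⟩
  length (filter (CatAdj? (main i)) (map main (allFin n)) ++ filter (CatAdj? (main i)) (leaves n m))
    ≡⟨ cong₂ (λ xs ys → length (xs ++ ys))
         (filter-map (CatAdj? (main i)) (PathAdj? i) main (id , id) (allFin n)) (leaves-at i) ⟩
  length (map (main {n} {m}) (filter (PathAdj? i) (allFin n)) ++ map (leaf i) (allFin m))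
    ≡⟨ length-++ (map main (filter (PathAdj? i) (allFin n))) ⟩
  length (map (main {n} {m}) (filter (PathAdj? i) (allFin n))) +ℕ length (map (leaf i) (allFin m))
    ≡⟨ cong₂ _+ℕ_
         (trans (length-map main (filter (PathAdj? i) (allFin n))) (length-filter-PathAdj i))
         (trans (length-map (leaf i) (allFin m)) (length-tabulate id)) ⟩
  pathDegree i +ℕ m ∎
  where open ≡-Reasoning

-- Edges

consecutive : ∀ n → List (Fin n × Fin n)
consecutive zero          = []
consecutive (suc zero)    = []
consecutive (suc (suc n)) = (zero , suc zero) ∷ map (map× suc suc) (consecutive (suc n))

-- Among the pairs starting at `zero` only the one with `suc zero` is an edge; the other pairs form
-- a shifted copy of the shorter path.
filter-pairs-allFin : ∀ n → filter (uncurry PathAdj?) (pairs (allFin n)) ≡ consecutive n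
filter-pairs-allFin zero          = refl
filter-pairs-allFin (suc zero)    = refl
filter-pairs-allFin (suc (suc n)) = begin
  filter R? (pairs (allFin (2 +ℕ n)))
    ≡⟨ cong (filter R? ∘ pairs) (allFin-suc (suc n)) ⟩
  filter R? (map (zero ,_) (map suc (allFin (suc n))) ++ pairs (map suc (allFin (suc n))))
    ≡⟨ filter-++ R? (map (zero ,_) (map suc (allFin (suc n)))) _ ⟩
  filter R? (map (zero ,_) (map suc (allFin (suc n)))) ++ filter R? (pairs (map suc (allFin (suc n))))
    ≡⟨ cong₂ _++_ from-zero
         (trans from-suc (cong (map (map× suc suc)) (filter-pairs-allFin (suc n)))) ⟩
  consecutive (2 +ℕ n) ∎
  where
  open ≡-Reasoning
  R? : ∀ {n} → Decidable (uncurry (PathAdj {n}))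
  R? = uncurry PathAdj?

  from-zero : filter R? (map (zero ,_) (map suc (allFin (suc n)))) ≡ (zero , suc zero) ∷ []
  from-zero =
    trans (filter-map R? (PathAdj? zero) (zero ,_) (id , id) (map suc (allFin (suc n))))
          (cong (map (zero ,_)) (filter-PathAdj-zero n))

  from-suc : filter R? (pairs (map suc (allFin (suc n)))) ≡
    map (map× suc suc) (filter R? (pairs (allFin (suc n))))
  from-suc =
    trans (cong (filter R?) (pairs-map suc (allFin (suc n))))
          (filter-map R? R? (map× suc suc)
            ((λ {(i , _)} → proj₁ (PathAdj-suc i)) , λ {(i , _)} → proj₂ (PathAdj-suc i))
            (pairs (allFin (suc n))))

pathEdges pendantEdges : ∀ n m → List (CatVertex n m × CatVertex n m)
pathEdges    n m = map (map× main main) (consecutive n)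
pendantEdges n m = cartesianProductWith (λ i k → main i , leaf i k) (allFin n) (allFin m)

-- The vertex list puts main vertices before leaves, so the pairs split into main-main, main-leaf
-- and leaf-leaf. The last kind has no edges, and each pendant edge appears with its main vertex
-- first.
edges-C : ∀ n m → edges (C n m) ↭ pathEdges n m ++ pendantEdges n m
edges-C n m = begin
  filter R? (pairs (mains ++ leaves n m))
    ↭⟨ filter-↭ R? (pairs-++ mains (leaves n m)) ⟩
  filter R? (pairs mains ++ cartesianProduct mains (leaves n m) ++ pairs (leaves n m))
    ≡⟨ trans (filter-++ R? (pairs mains) _)
             (cong (filter R? (pairs mains) ++_) (filter-++ R? (cartesianProduct mains (leaves n m)) _)) ⟩
  filter R? (pairs mains) ++ filter R? (cartesianProduct mains (leaves n m)) ++ filter R? (pairs (leaves n m))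
    ≡⟨ cong₂ _++_ within-path (cong₂ _++_ (path-to-leaves (allFin n)) within-leaves) ⟩
  pathEdges n m ++ pendantEdges n m ++ []
    ≡⟨ cong (pathEdges n m ++_) (++-identityʳ (pendantEdges n m)) ⟩
  pathEdges n m ++ pendantEdges n m ∎
  where
  open PermutationReasoning
  R? : Decidable (uncurry (CatAdj {n} {m}))
  R? = uncurry CatAdj?

  mains : List (CatVertex n m)
  mains = map main (allFin n)

  within-path : filter R? (pairs mains) ≡ pathEdges n m
  within-path =
    trans (cong (filter R?) (pairs-map main (allFin n)))
   (trans (filter-map R? (uncurry PathAdj?) (map× main main) (id , id) (pairs (allFin n)))
          (cong (map (map× main main)) (filter-pairs-allFin n)))

  -- Stated for an arbitrary list `is`, since the induction shortens the list of main vertices while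
  -- the leaves stay fixed.
  path-to-leaves : ∀ is → filter R? (cartesianProduct (map main is) (leaves n m)) ≡
    cartesianProductWith (λ i k → main i , leaf i k) is (allFin m)
  path-to-leaves []       = refl
  path-to-leaves (i ∷ is) =
    trans (filter-++ R? (map (main i ,_) (leaves n m)) _)
          (cong₂ _++_
            (trans (filter-map R? (CatAdj? (main i)) (main i ,_) (id , id) (leaves n m))
            (trans (cong (map (main i ,_)) (leaves-at i)) (sym (map-∘ (allFin m)))))
            (path-to-leaves is))

  within-leaves : filter R? (pairs (leaves n m)) ≡ []
  -- Carrying `v ≡ leaf i k` for both ends exposes the constructors, so that adjacency reduces to
  -- `⊥`.
  within-leaves = filter-none R? (All-pairs {P = λ v → ∃₂ λ i k → v ≡ leaf i k}
    (λ { (_ , _ , refl) (_ , _ , refl) () })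
    (All-cartesianProductWith leaf (λ i k → i , k , refl) (allFin n) (allFin m)))

-- The Sigma index

pathWeight : ℕ → Fin n × Fin n → ℤ
pathWeight m (i , j) = (+ (pathDegree i +ℕ m) - + (pathDegree j +ℕ m)) ^ 2

-- Kept as a sum of equal terms, one per leaf: it matches the pendant edges entry by entry and
-- evaluates by computation at `m` = 3.
pendantWeight : ∀ m → Fin n → ℤ
pendantWeight m i = sumℤ (map (const ((+ (pathDegree i +ℕ m) - + 1) ^ 2)) (allFin m))

-- Reordering the edges preserves the sum, and the degree formulas then replace the tree by data on
-- `Fin n` alone.
σ-C : ∀ n m → σ (C n m) ≡
  sumℤ (map (pathWeight m) (consecutive n)) + sumℤ (map (pendantWeight m) (allFin n))
σ-C n m = begin
  sumℤ (map w (edges (C n m)))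
    ≡⟨ sumℤ-↭ (map⁺ w (edges-C n m)) ⟩
  sumℤ (map w (pathEdges n m ++ pendantEdges n m))
    ≡⟨ cong sumℤ (map-++ w (pathEdges n m) (pendantEdges n m)) ⟩
  sumℤ (map w (pathEdges n m) ++ map w (pendantEdges n m))
    ≡⟨ sumℤ-++ (map w (pathEdges n m)) _ ⟩
  sumℤ (map w (pathEdges n m)) + sumℤ (map w (pendantEdges n m))
    ≡⟨ cong₂ _+_ path-part pendant-part ⟩
  sumℤ (map (pathWeight m) (consecutive n)) + sumℤ (map (pendantWeight m) (allFin n)) ∎
  where
  open ≡-Reasoning
  difference² : ℕ → ℕ → ℤ
  difference² d e = (+ d - + e) ^ 2

  w : CatVertex n m × CatVertex n m → ℤ
  w (u , v) = difference² (degree (C n m) u) (degree (C n m) v)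

  path-part : sumℤ (map w (pathEdges n m)) ≡ sumℤ (map (pathWeight m) (consecutive n))
  path-part = cong sumℤ (trans (sym (map-∘ (consecutive n)))
    (map-cong (λ (i , j) → cong₂ difference² (degree-main i) (degree-main j)) (consecutive n)))

  pendant-part : sumℤ (map w (pendantEdges n m)) ≡ sumℤ (map (pendantWeight m) (allFin n))
  pendant-part = trans (sumℤ-cartesianProductWith w _ (allFin n) (allFin m))
    (cong sumℤ (map-cong (λ i → cong sumℤ (map-cong
      (λ k → cong₂ difference² (degree-main i) (degree-leaf i k)) (allFin m))) (allFin n)))

-- The shift by `suc` discards the first path edge. All remaining edges join two interior vertices
-- and weigh 0, except the last, which weighs 1.
sum-pathWeight-suc : ∀ n →
  sumℤ (map (pathWeight 3 ∘ map× suc suc) (consecutive (2 +ℕ n))) ≡ + 1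
sum-pathWeight-suc zero    = refl
sum-pathWeight-suc (suc n) =
  -- The leading edge is interior, hence the 0 removed here. A second shift leaves the weights
  -- unchanged by computation, so the induction hypothesis applies.
  trans (ℤ.+-identityˡ _)
 (trans (sumℤ-map-∘ (pathWeight 3 ∘ map× suc suc) (map× suc suc) (consecutive (2 +ℕ n)))
        (sum-pathWeight-suc n))

-- This is where at least three path vertices matter: the first and last edges are then distinct and
-- contribute 1 each, whereas on two vertices the single edge joins equal degrees.
sum-pathWeight : ∀ n → sumℤ (map (pathWeight 3) (consecutive (3 +ℕ n))) ≡ + 2
sum-pathWeight n = cong (λ s → + 1 + s)
  (trans (sumℤ-map-∘ (pathWeight 3) (map× suc suc) (consecutive (2 +ℕ n))) (sum-pathWeight-suc n))

-- Without the first vertex there remain `n` interior vertices and the far end. As with the path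
-- edges, the weights are stable under a further shift, which makes the induction work.
sum-pendantWeight-suc : ∀ n →
  sumℤ (map (pendantWeight 3 ∘ suc) (allFin (suc n))) ≡ + 48 * + n + + 27
sum-pendantWeight-suc zero    = refl
sum-pendantWeight-suc (suc n) = begin
  sumℤ (map (pendantWeight 3 ∘ suc) (allFin (2 +ℕ n)))
    ≡⟨ cong (sumℤ ∘ map (pendantWeight 3 ∘ suc)) (allFin-suc (suc n)) ⟩
  + 48 + sumℤ (map (pendantWeight 3 ∘ suc) (map suc (allFin (suc n))))
    ≡⟨ cong (λ s → + 48 + s)
         (trans (sumℤ-map-∘ (pendantWeight 3 ∘ suc) suc (allFin (suc n))) (sum-pendantWeight-suc n)) ⟩
  + 48 + (+ 48 * + n + + 27)
    ≡⟨ rearrange (+ n) ⟩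
  + 48 * + suc n + + 27 ∎
  where
  open ≡-Reasoning
  -- `+ suc n` computes to `+ 1 + + n`, the form that the ring solver is given.
  rearrange : ∀ x → + 48 + (+ 48 * x + + 27) ≡ + 48 * (+ 1 + x) + + 27
  rearrange = solve-∀

sum-pendantWeight : ∀ n →
  sumℤ (map (pendantWeight 3) (allFin (2 +ℕ n))) ≡ + 27 + (+ 48 * + n + + 27)
sum-pendantWeight n = begin
  sumℤ (map (pendantWeight 3) (allFin (2 +ℕ n)))
    ≡⟨ cong (sumℤ ∘ map (pendantWeight 3)) (allFin-suc (suc n)) ⟩
  + 27 + sumℤ (map (pendantWeight 3) (map suc (allFin (suc n))))
    ≡⟨ cong (λ s → + 27 + s)
         (trans (sumℤ-map-∘ (pendantWeight 3) suc (allFin (suc n))) (sum-pendantWeight-suc n)) ⟩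
  + 27 + (+ 48 * + n + + 27) ∎
  where open ≡-Reasoning

proposition3p6 : (n : ℕ) → n ≥ 3 → σ (C n 3) ≡ + 48 * (+ n - + 2) + + 56
proposition3p6 (suc (suc (suc n))) (s≤s (s≤s (s≤s _))) = begin
  σ (C (3 +ℕ n) 3)
    ≡⟨ σ-C (3 +ℕ n) 3 ⟩
  sumℤ (map (pathWeight 3) (consecutive (3 +ℕ n))) + sumℤ (map (pendantWeight 3) (allFin (3 +ℕ n)))
    -- The argument `suc n` is the number of interior vertices, as `3 +ℕ n` is `2 +ℕ suc n`.
    ≡⟨ cong₂ _+_ (sum-pathWeight n) (sum-pendantWeight (suc n)) ⟩
  + 2 + (+ 27 + (+ 48 * + suc n + + 27))
    -- The difference `+ (3 +ℕ n) - + 2` evaluates to `+ suc n`, so only the constants 2 + 27 + 27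
    -- remain to be collected.
    ≡⟨ rearrange (+ suc n) ⟩
  + 48 * (+ (3 +ℕ n) - + 2) + + 56 ∎
  where
  open ≡-Reasoning
  rearrange : ∀ x → + 2 + (+ 27 + (+ 48 * x + + 27)) ≡ + 48 * x + + 56
  rearrange = solve-∀
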